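{- Let $\vec S$ be a finite separation system which is submodular. Then there exist a finite universe of separations $\vec U$ and an embedding $\varphi\colon \vec S\to\vec U$ of separation systems such that the image $\varphi(\vec S)$ is submodular in $\vec U$.
   Context: A separation system is a partially ordered set $\vec S$ with an order-reversing involution ${}^*$. It is called submodular if any two $r,s\in\vec S$ have a supremum or an infimum (or both) in the poset $\vec S$. A universe of separations is a separation system $\vec U$ whose poset is a lattice (a non-empty poset in which any two elements $a,b$ have a supremum $a\vee b$ and an infimum $a\wedge b$). A subsystem of a separation system is a subset closed under its involution, with the restricted order and involution. A subsystem $\vec T$ of a universe $\vec U$ is submodular in $\vec U$ if for all $r,s\in\vec T$ at least one of $r\vee s$ and $r\wedge s$ (taken in $\vec U$) lies in $\vec T$. An embedding $\varphi\colon\vec S\to\vec U$ of separation systems is an injective map with $r\le s\Leftrightarrow\varphi(r)\le\varphi(s)$ and $\varphi(s^*)=\varphi(s)^*$ for all $r,s\in\vec S$, i.e. an isomorphism of separation systems onto its image. -}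

module Defs where

open import Algebra.Core using (Op₁; Op₂)
open import Algebra.Definitions using (Involutive)
open import Data.Fin.Base using (Fin)
open import Data.Product.Base using (∃; ∃-syntax; _×_; _,_)
open import Data.Sum.Base using (_⊎_)
open import Function.Base using (flip)
open import Function.Bundles using (Inverse)
open import Level using (Level; _⊔_; suc)
open import Relation.Binary.Bundles using (Poset)
open import Relation.Binary.Core using (Rel)
open import Relation.Binary.Definitions using (Antitonic₁; _Respects_)
open import Relation.Binary.Lattice.Structures using (IsLattice)
open import Relation.Binary.Morphism.Structures using (IsOrderMonomorphism)
open import Relation.Binary.PropositionalEquality.Properties using (setoid)
open import Relation.Unary using (Pred; _∈_)

private
  variable
    a c ℓ ℓ₁ ℓ₂ c′ ℓ₁′ ℓ₂′ : Level

IsSupremumOf : {A : Set a} → Rel A ℓ → A → A → A → Set (a ⊔ ℓ)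
IsSupremumOf _≤_ x y s = x ≤ s × y ≤ s × (∀ z → x ≤ z → y ≤ z → s ≤ z)

IsInfimumOf : {A : Set a} → Rel A ℓ → A → A → A → Set (a ⊔ ℓ)
IsInfimumOf _≤_ = IsSupremumOf (flip _≤_)

-- Equality of separations is the equality _≈_ of the underlying poset.
record SeparationSystem (c ℓ₁ ℓ₂ : Level) : Set (suc (c ⊔ ℓ₁ ⊔ ℓ₂)) where
  infix 9 _*
  field
    poset : Poset c ℓ₁ ℓ₂

  open Poset poset public

  field
    _*              : Op₁ Carrier
    *-involutive    : Involutive _≈_ _*
    *-order-reverse : Antitonic₁ _≤_ _≤_ _*

IsFinite : SeparationSystem c ℓ₁ ℓ₂ → Set (c ⊔ ℓ₁)
IsFinite S = ∃[ n ] Inverse (SeparationSystem.Eq.setoid S) (setoid (Fin n))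

IsSubmodular : SeparationSystem c ℓ₁ ℓ₂ → Set (c ⊔ ℓ₂)
IsSubmodular S = ∀ r s → ∃ (IsSupremumOf _≤_ r s) ⊎ ∃ (IsInfimumOf _≤_ r s)
  where open SeparationSystem S

record Universe (c ℓ₁ ℓ₂ : Level) : Set (suc (c ⊔ ℓ₁ ⊔ ℓ₂)) where
  infixr 6 _∨_
  infixr 7 _∧_
  field
    separationSystem : SeparationSystem c ℓ₁ ℓ₂

  open SeparationSystem separationSystem public

  field
    _∨_       : Op₂ Carrier
    _∧_       : Op₂ Carrier
    isLattice : IsLattice _≈_ _≤_ _∨_ _∧_
    -- IsLattice does not exclude the empty carrier.
    nonEmpty  : Carrier

record Subsystem (S : SeparationSystem c ℓ₁ ℓ₂) (ℓ : Level) :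
                 Set (c ⊔ ℓ₁ ⊔ suc ℓ) where
  open SeparationSystem S using (Carrier; _≈_; _*)
  field
    elements : Pred Carrier ℓ
    resp     : elements Respects _≈_
    *-closed : ∀ {s} → s ∈ elements → s * ∈ elements

IsSubmodularIn : (U : Universe c ℓ₁ ℓ₂) →
                 Subsystem (Universe.separationSystem U) ℓ → Set (c ⊔ ℓ)
IsSubmodularIn U T = ∀ r s → r ∈ elements → s ∈ elements →
                     (r ∨ s) ∈ elements ⊎ (r ∧ s) ∈ elements
  where
  open Universe U using (_∨_; _∧_)
  open Subsystem T using (elements)

record Embedding (S : SeparationSystem c ℓ₁ ℓ₂)
                 (U : SeparationSystem c′ ℓ₁′ ℓ₂′) :
                 Set (c ⊔ ℓ₁ ⊔ ℓ₂ ⊔ c′ ⊔ ℓ₁′ ⊔ ℓ₂′) where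
  private
    module S = SeparationSystem S
    module U = SeparationSystem U

  field
    ⟦_⟧                 : S.Carrier → U.Carrier
    isOrderMonomorphism : IsOrderMonomorphism S._≈_ U._≈_ S._≤_ U._≤_ ⟦_⟧
    *-homo              : ∀ s → ⟦ s S.* ⟧ U.≈ ⟦ s ⟧ U.*

  open IsOrderMonomorphism isOrderMonomorphism public

  image : Subsystem U (c ⊔ ℓ₁′)
  image = record
    { elements = λ u → ∃[ s ] ⟦ s ⟧ U.≈ u
    ; resp     = λ { u≈v (s , φs≈u) → s , U.Eq.trans φs≈u u≈v }
    ; *-closed = λ { (s , φs≈u) → s S.* , U.Eq.trans (*-homo s) (*-cong φs≈u) }
    }
    where
    *-cong : ∀ {u v} → u U.≈ v → u U.* U.≈ v U.*
    *-cong u≈v = U.antisym (U.*-order-reverse (U.reflexive (U.Eq.sym u≈v)))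
                           (U.*-order-reverse (U.reflexive u≈v))

-- Submodularity makes ≤ decidable: r ≤ s can be read off from a supremum or
-- infimum of r and s. The universe is the Dedekind–MacNeille completion of S,
-- which preserves every supremum and infimum that exists in S. It is obtained
-- from the symmetric relation r ⟂ s :⇔ r ≤ s * as its lattice of closed sets
-- A = A ᗮ ᗮ, with involution A ↦ A ᗮ and s embedded as the closure of {s}.
module Submission where

open import Defs
open import Level using (Level; 0ℓ)
open import Data.Product.Base using (Σ-syntax; _×_)

open import Data.Bool.Properties as Bool using (T-≡)
open import Data.Fin.Base using (Fin; zero; suc)
open import Data.Fin.Properties using (all?; inj⇒≟)
open import Data.Fin.Subset using (Side; inside; outside; Subset; _∈_; _⊆_; _∪_; ⁅_⁆; ⊥)
open import Data.Fin.Subset.Properties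
  using (_∈?_; ⊆-antisym; ⊆-isPartialOrder; p⊆p∪q; q⊆p∪q; x∈p∪q⁻; x∈⁅x⁆; x∈⁅y⁆⇒x≡y)
open import Data.List.Base using (List; []; _∷_; cartesianProductWith; deduplicate; length; lookup)
open import Data.List.Membership.Propositional.Properties using (∈-cartesianProductWith⁺; ∈-lookup)
import Data.List.Relation.Unary.All as All
open import Data.List.Relation.Unary.Any as Any using (here; there)
open import Data.List.Relation.Unary.AllPairs.Core using (_∷_)
open import Data.List.Relation.Unary.Enumerates.Setoid using (IsEnumeration)
open import Data.List.Relation.Unary.Enumerates.Setoid.Properties using (deduplicate⁺; lookup-surjective)
open import Data.List.Relation.Unary.Unique.Setoid using (Unique)
open import Data.List.Relation.Unary.Unique.DecSetoid.Properties using (deduplicate-!)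
open import Data.Nat.Base using (ℕ; zero; suc)
open import Data.Product.Base using (∃-syntax; _,_)
open import Data.Sum.Base as Sum using (inj₁; inj₂; [_,_])
open import Data.Vec.Base using ([]; _∷_; tabulate)
open import Data.Vec.Properties using ([]=⇒lookup; lookup⇒[]=; lookup∘tabulate; ≡-dec)
open import Function.Base using (_∘_)
open import Function.Bundles using (Inverse; Equivalence)
open import Function.Construct.Symmetry using () renaming (inverse to Inverse-sym)
open import Function.Properties.Bijection using (Bijection⇒Inverse)
open import Function.Properties.Inverse using (Inverse⇒Injection)
open import Relation.Binary.Bundles using (Setoid; DecSetoid)
open import Relation.Binary.Core using (Rel)
import Relation.Binary.Construct.Flip.EqAndOrd as Flip
import Relation.Binary.Construct.On as On
open import Relation.Binary.Definitions using (Decidable; Symmetric)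
open import Relation.Binary.Lattice.Bundles using (Lattice)
open import Relation.Binary.Lattice.Properties.JoinSemilattice using (∨-cong)
open import Relation.Binary.Lattice.Properties.MeetSemilattice using (∧-cong)
open import Relation.Binary.PropositionalEquality.Core
  using (_≡_; refl; sym; trans; cong; subst)
open import Relation.Binary.PropositionalEquality.Properties using (setoid; decSetoid)
open import Relation.Nullary.Decidable using (Dec; ⌊_⌋; map′; toWitness; fromWitness; _→-dec_)
open import Relation.Nullary.Negation using (contradiction)

private
  variable
    a ℓ : Level
    n   : ℕ

-- Finiteness from enumerating lists

module _ (S : Setoid a ℓ) where
  open Setoid S using (_≈_) renaming (sym to ≈-sym)

  lookup-injective : ∀ {xs} → Unique S xs → ∀ {i j} → lookup xs i ≈ lookup xs j → i ≡ j
  lookup-injective (_   ∷ _)   {zero}  {zero}  _  = refl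
  lookup-injective (x≉  ∷ _)   {zero}  {suc j} eq = contradiction eq (All.lookup x≉ (∈-lookup j))
  lookup-injective (x≉  ∷ _)   {suc i} {zero}  eq = contradiction (≈-sym eq) (All.lookup x≉ (∈-lookup i))
  lookup-injective (_   ∷ xs!) {suc i} {suc j} eq = cong suc (lookup-injective xs! eq)

module _ (DS : DecSetoid a ℓ) where
  open DecSetoid DS using (_≟_; reflexive) renaming (setoid to S)

  -- Once duplicates up to `≈` are removed, indexing into the list is injective and still
  -- surjective.
  enumeration⇒finite : ∀ {xs} → IsEnumeration S xs → ∃[ n ] Inverse S (setoid (Fin n))
  enumeration⇒finite {xs} enum = length ys , Inverse-sym (Bijection⇒Inverse record
    { to        = lookup ys
    ; cong      = λ { refl → reflexive refl }
    ; bijective = lookup-injective S (deduplicate-! DS xs)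
                , lookup-surjective S (deduplicate⁺ DS enum)
    })
    where ys = deduplicate _≟_ xs

-- Enumeration of all subsets

sides : List Side
sides = inside ∷ outside ∷ []

subsets : ∀ n → List (Subset n)
subsets zero    = [] ∷ []
subsets (suc n) = cartesianProductWith _∷_ sides (subsets n)

subsets-enumerates : IsEnumeration (setoid (Subset n)) (subsets n)
subsets-enumerates [] = here refl
subsets-enumerates (inside ∷ p) =
  ∈-cartesianProductWith⁺ _∷_ {xs = sides} (here refl) (subsets-enumerates p)
subsets-enumerates (outside ∷ p) =
  ∈-cartesianProductWith⁺ _∷_ {xs = sides} (there (here refl)) (subsets-enumerates p)

-- The universe of closed sets of a symmetric relation

module Polarity {n} (_⟂_ : Rel (Fin n) ℓ) (_⟂?_ : Decidable _⟂_) (⟂-sym : Symmetric _⟂_) where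

  infix 9 _ᗮ

  private
    annihilates? : ∀ A i → Dec (∀ j → j ∈ A → j ⟂ i)
    annihilates? A i = all? λ j → (j ∈? A) →-dec (j ⟂? i)

  -- A Boolean vector rather than a predicate, so that subsets can be listed and compared.
  _ᗮ : Subset n → Subset n
  A ᗮ = tabulate λ i → ⌊ annihilates? A i ⌋

  private
    variable
      A B C : Subset n
      i j   : Fin n

  ∈ᗮ⁺ : (∀ j → j ∈ A → j ⟂ i) → i ∈ A ᗮ
  ∈ᗮ⁺ {A} {i} h = lookup⇒[]= i (A ᗮ)
    (trans (lookup∘tabulate _ i) (Equivalence.to T-≡ (fromWitness {a? = annihilates? A i} h)))

  ∈ᗮ⁻ : i ∈ A ᗮ → j ∈ A → j ⟂ i
  ∈ᗮ⁻ {i} {A} i∈Aᗮ = toWitness {a? = annihilates? A i}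
    (Equivalence.from T-≡ (trans (sym (lookup∘tabulate _ i)) ([]=⇒lookup i∈Aᗮ))) _

  -- By symmetry of `⟂`, the map `ᗮ` forms a Galois connection with itself.
  ⊆ᗮᗮ : A ⊆ A ᗮ ᗮ
  ⊆ᗮᗮ x∈A = ∈ᗮ⁺ λ j j∈Aᗮ → ⟂-sym (∈ᗮ⁻ j∈Aᗮ x∈A)

  ᗮ-antitone : A ⊆ B → B ᗮ ⊆ A ᗮ
  ᗮ-antitone A⊆B x∈Bᗮ = ∈ᗮ⁺ λ j j∈A → ∈ᗮ⁻ x∈Bᗮ (A⊆B j∈A)

  -- This is involutivity of `ᗮ` once equality of `A` and `B` is read as `A ᗮ ≡ B ᗮ`.
  ᗮᗮᗮ : ∀ A → A ᗮ ᗮ ᗮ ≡ A ᗮ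
  ᗮᗮᗮ A = ⊆-antisym (ᗮ-antitone ⊆ᗮᗮ) ⊆ᗮᗮ

  ∈⁅⁆ᗮ⁺ : j ⟂ i → i ∈ ⁅ j ⁆ ᗮ
  ∈⁅⁆ᗮ⁺ {j} j⟂i = ∈ᗮ⁺ λ k k∈⁅j⁆ → subst (_⟂ _) (sym (x∈⁅y⁆⇒x≡y j k∈⁅j⁆)) j⟂i

  ∈⁅⁆ᗮ⁻ : i ∈ ⁅ j ⁆ ᗮ → j ⟂ i
  ∈⁅⁆ᗮ⁻ {j = j} i∈ = ∈ᗮ⁻ i∈ (x∈⁅x⁆ j)

  -- Closed sets are represented by arbitrary generating sets, so that
  -- equality and order compare the closures: B ᗮ ⊆ A ᗮ iff A ᗮ ᗮ ⊆ B ᗮ ᗮ.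
  separationSystem : SeparationSystem 0ℓ 0ℓ 0ℓ
  separationSystem = record
    { poset           = record
      { isPartialOrder = On.isPartialOrder _ᗮ (Flip.isPartialOrder (⊆-isPartialOrder n)) }
    ; _*              = _ᗮ
    ; *-involutive    = ᗮᗮᗮ
    ; *-order-reverse = ᗮ-antitone
    }

  open SeparationSystem separationSystem using (_≈_; _≤_)

  ∪-least : A ≤ C → B ≤ C → A ∪ B ≤ C
  ∪-least {A = A} {B = B} A≤C B≤C x∈Cᗮ =
    ∈ᗮ⁺ λ j j∈A∪B → [ ∈ᗮ⁻ (A≤C x∈Cᗮ) , ∈ᗮ⁻ (B≤C x∈Cᗮ) ] (x∈p∪q⁻ A B j∈A∪B)

  universe : Universe 0ℓ 0ℓ 0ℓ
  universe = record
    { separationSystem = separationSystem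
    -- Generators of two closed sets together generate their join; the meet is the De Morgan dual.
    ; _∨_       = _∪_
    ; _∧_       = λ A B → (A ᗮ ∪ B ᗮ) ᗮ
    ; isLattice = record
      { isPartialOrder = SeparationSystem.isPartialOrder separationSystem
      ; supremum       = λ A B →
          ᗮ-antitone (p⊆p∪q B) , ᗮ-antitone (q⊆p∪q A B) , λ C → ∪-least {A} {C} {B}
      ; infimum        = λ A B →
          ⊆ᗮᗮ ∘ p⊆p∪q (B ᗮ)
        , ⊆ᗮᗮ ∘ q⊆p∪q (A ᗮ) (B ᗮ)
        -- `C ᗮ` is above `A ᗮ` and `B ᗮ`, hence above their join; reversing the order again leaves
        -- `C ᗮ ᗮ ᗮ`, which is `C ᗮ`.
        , λ C C≤A C≤B → subst ((A ᗮ ∪ B ᗮ) ᗮ ᗮ ⊆_) (ᗮᗮᗮ C)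
            (ᗮ-antitone (∪-least {A ᗮ} {C ᗮ} {B ᗮ} (ᗮ-antitone C≤A) (ᗮ-antitone C≤B)))
      }
    ; nonEmpty  = ⊥
    }

  finite : IsFinite separationSystem
  -- Different subsets may generate the same closed set, so the list of subsets can have repetitions
  -- up to `≈`.
  finite = enumeration⇒finite (On.decSetoid (decSetoid (≡-dec Bool._≟_)) _ᗮ)
    λ A → Any.map (cong _ᗮ) (subsets-enumerates A)


-- Embedding a submodular separation system

module _ {c ℓ₁ ℓ₂} (S : SeparationSystem c ℓ₁ ℓ₂) where
  private module S = SeparationSystem S

  -- `r ≤ s` holds exactly when a supremum of the two equals `s`, and exactly when an infimum equals
  -- `r`.
  submodular⇒≤-decidable : (∀ x y → Dec (x S.≈ y)) → IsSubmodular S → Decidable S._≤_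
  submodular⇒≤-decidable _≟_ submodular r s with submodular r s
  ... | inj₁ (t , r≤t , s≤t , t-least) =
    map′ (λ t≈s → S.trans r≤t (S.reflexive t≈s))
         (λ r≤s → S.antisym (t-least s r≤s S.refl) s≤t)
         (t ≟ s)
  ... | inj₂ (t , t≤r , t≤s , t-greatest) =
    map′ (λ t≈r → S.trans (S.reflexive (S.Eq.sym t≈r)) t≤s)
         (λ r≤s → S.antisym t≤r (t-greatest r S.refl r≤s))
         (t ≟ r)

  -- Provides the symmetry of `⟂`.
  ≤*-swap : ∀ {x y} → x S.≤ y S.* → y S.≤ x S.*
  ≤*-swap x≤y* = S.trans (S.reflexive (S.Eq.sym (S.*-involutive _))) (S.*-order-reverse x≤y*)

  *-reflects-≤ : ∀ {x y} → x S.* S.≤ y S.* → y S.≤ x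
  *-reflects-≤ x*≤y* = S.trans (≤*-swap x*≤y*) (S.reflexive (S.*-involutive _))

  module Completion {n} (S≅Fin : Inverse S.Eq.setoid (setoid (Fin n)))
                    (_≤?_ : Decidable S._≤_) where
    open Inverse S≅Fin using (to; from; to-cong; strictlyInverseʳ)

    private
      from-to≤ : ∀ {s} → from (to s) S.≤ s
      from-to≤ = S.reflexive (strictlyInverseʳ _)

      ≤from-to : ∀ {s} → s S.≤ from (to s)
      ≤from-to = S.reflexive (S.Eq.sym (strictlyInverseʳ _))

    open Polarity (λ i j → from i S.≤ from j S.*) (λ i j → from i ≤? (from j S.*)) ≤*-swap public
    open Universe universe using (_∨_; _∧_; _≈_; _≤_)

    private
      lattice : Lattice _ _ _
      lattice = record { isLattice = Universe.isLattice universe }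

    φ : S.Carrier → Subset n
    φ s = ⁅ to s ⁆

    ∈φᗮ⁺ : ∀ {s i} → s S.≤ from i S.* → i ∈ φ s ᗮ
    ∈φᗮ⁺ s≤i* = ∈⁅⁆ᗮ⁺ (S.trans from-to≤ s≤i*)

    ∈φᗮ⁻ : ∀ {s i} → i ∈ φ s ᗮ → s S.≤ from i S.*
    ∈φᗮ⁻ i∈ = S.trans ≤from-to (∈⁅⁆ᗮ⁻ i∈)

    -- `φ s ᗮ` consists of the indices of elements below `s *`, so `s *` itself is the strongest
    -- test element for conditions on all of `φ s ᗮ`.
    to-*∈φᗮ : ∀ s → to (s S.*) ∈ φ s ᗮ
    to-*∈φᗮ s = ∈φᗮ⁺ (≤*-swap from-to≤)

    φ-mono : ∀ {r s} → r S.≤ s → φ r ≤ φ s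
    φ-mono r≤s i∈ = ∈φᗮ⁺ (S.trans r≤s (∈φᗮ⁻ i∈))

    φ-cancel : ∀ {r s} → φ r ≤ φ s → r S.≤ s
    φ-cancel {s = s} φr≤φs =
      *-reflects-≤ (S.trans ≤from-to (≤*-swap (∈φᗮ⁻ (φr≤φs (to-*∈φᗮ s)))))

    -- The `ᗮ` of either side consists of the indices of elements below `s`.
    φ-*-homo : ∀ s → φ (s S.*) ≈ φ s ᗮ
    φ-*-homo s = ⊆-antisym
      (λ i∈ → ∈ᗮ⁺ λ j j∈ → S.trans (≤*-swap (∈φᗮ⁻ j∈)) (∈φᗮ⁻ i∈))
      (λ i∈ → ∈φᗮ⁺ (S.trans ≤from-to (∈ᗮ⁻ i∈ (to-*∈φᗮ s))))

    embedding : Embedding S separationSystem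
    embedding = record
      { ⟦_⟧                 = φ
      ; isOrderMonomorphism = record
        { isOrderHomomorphism = record
          { cong = λ r≈s → cong (λ i → ⁅ i ⁆ ᗮ) (to-cong r≈s)
          ; mono = φ-mono
          }
        ; injective           = λ {r} {s} φr≈φs → S.antisym
            (φ-cancel {r} {s} (Universe.reflexive universe {φ r} {φ s} φr≈φs))
            (φ-cancel {s} {r} (Universe.reflexive universe {φ s} {φ r} (sym φr≈φs)))
        ; cancel              = φ-cancel
        }
      ; *-homo              = φ-*-homo
      }

    -- An index `i` lies in the `ᗮ` of the left side when `from i *` is above `t`, and in that of
    -- the right side when it is above both `r` and `s`.
    φ-preserves-supremum : ∀ {r s t} → IsSupremumOf S._≤_ r s t → φ t ≈ φ r ∨ φ s
    φ-preserves-supremum {r} {s} {t} (r≤t , s≤t , t-least) = ⊆-antisym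
      (∪-least {φ r} {φ t} {φ s} (φ-mono r≤t) (φ-mono s≤t))
      (λ i∈ → ∈φᗮ⁺ (t-least _
        (∈φᗮ⁻ (ᗮ-antitone (p⊆p∪q _) i∈))
        (∈φᗮ⁻ (ᗮ-antitone (q⊆p∪q (φ r) _) i∈))))

    -- A member `j` of `φ r ∧ φ s` lies in the closures of `φ r` and `φ s`, so `from j` is a common
    -- lower bound of `r` and `s` and hence below `t`.
    φ-preserves-infimum : ∀ {r s t} → IsInfimumOf S._≤_ r s t → φ t ≈ φ r ∧ φ s
    φ-preserves-infimum {r} {s} {t} (t≤r , t≤s , t-greatest) = ⊆-antisym
      (λ i∈ → ∈ᗮ⁺ λ j j∈ → S.trans
        (t-greatest _
          (generated-below r (ᗮ-antitone (p⊆p∪q _) j∈))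
          (generated-below s (ᗮ-antitone (q⊆p∪q (φ r ᗮ) _) j∈)))
        (∈φᗮ⁻ i∈))
      (Lattice.∧-greatest lattice {φ t} {φ r} {φ s} (φ-mono t≤r) (φ-mono t≤s))
      where
      generated-below : ∀ s {j} → j ∈ φ s ᗮ ᗮ → from j S.≤ s
      generated-below s j∈ = *-reflects-≤ (S.trans ≤from-to (∈ᗮ⁻ j∈ (to-*∈φᗮ s)))

    image-submodular : IsSubmodular S → IsSubmodularIn universe (Embedding.image embedding)
    image-submodular submodular A B (r , φr≈A) (s , φs≈B) = Sum.map
      -- `A` and `B` agree with `φ r` and `φ s` only up to `≈`, hence the congruence of the lattice
      -- operations.
      (λ (t , sup) → t , trans (φ-preserves-supremum sup)
        (∨-cong (Lattice.joinSemilattice lattice) {φ r} {A} {φ s} {B} φr≈A φs≈B))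
      (λ (t , inf) → t , trans (φ-preserves-infimum inf)
        (∧-cong (Lattice.meetSemilattice lattice) {φ r} {A} {φ s} {B} φr≈A φs≈B))
      (submodular r s)

theorem1 : ∀ {c ℓ₁ ℓ₂ : Level} (S : SeparationSystem c ℓ₁ ℓ₂) →
    IsFinite S → IsSubmodular S →
    Σ[ U ∈ Universe 0ℓ 0ℓ 0ℓ ]
    (IsFinite (Universe.separationSystem U) ×
    Σ[ φ ∈ Embedding S (Universe.separationSystem U) ]
    IsSubmodularIn U (Embedding.image φ))
theorem1 S (n , S≅Fin) submodular =
  universe , finite , embedding , image-submodular submodular
  where
  open Completion S S≅Fin
    (submodular⇒≤-decidable S (inj⇒≟ (Inverse⇒Injection S≅Fin)) submodular)
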